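{- A reduct of a symmetrically indivisible structure to a sub-language is not necessarily symmetrically indivisible. That is, there exist a first-order language $\mathcal{L}$, a sub-language $\mathcal{L}_0\subseteq\mathcal{L}$ and a symmetrically indivisible $\mathcal{L}$-structure $\mathcal{M}$ such that the reduct $\mathcal{M}\upharpoonright\mathcal{L}_0$ is not symmetrically indivisible.
   Context: A substructure $\mathcal{N}\subseteq\mathcal{M}$ is symmetrically embedded in $\mathcal{M}$ if every automorphism of $\mathcal{N}$ extends to an automorphism of $\mathcal{M}$. A structure $\mathcal{M}$ is symmetrically indivisible if for every colouring of its universe in two colours there is a monochromatic substructure $\mathcal{M}'\subseteq\mathcal{M}$ such that $\mathcal{M}'\cong\mathcal{M}$ and $\mathcal{M}'$ is symmetrically embedded in $\mathcal{M}$. -}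

module Defs where

open import Data.Bool.Base using (Bool)
open import Data.Irrelevant as Irrelevant using (Irrelevant; [_])
open import Data.Nat.Base using (ℕ)
open import Data.Product.Base using (Σ-syntax; ∃-syntax; _×_)
open import Data.Refinement.Base using (Refinement; value; _,_)
open import Data.Vec.Base using (Vec; []; _∷_; map)
open import Data.Vec.Relation.Unary.All using (All; []; _∷_)
open import Function.Bundles using (_↔_; _⇔_; module Inverse)
open import Level using (0ℓ)
open import Relation.Binary.PropositionalEquality using (_≡_)
open import Relation.Unary using (Pred)

-- Symbols are indexed by their arity; constants are function symbols of arity 0.
record Language : Set₁ where
  field
    Functions : ℕ → Set
    Relations : ℕ → Set

open Language public

record Structure (L : Language) : Set₁ where
  field
    Carrier : Set
    fun     : ∀ {n} → Functions L n → Vec Carrier n → Carrier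
    rel     : ∀ {n} → Relations L n → Vec Carrier n → Set

open Structure public

record SubLanguage (L : Language) : Set₁ where
  field
    KeepsFunction : ∀ {n} → Pred (Functions L n) 0ℓ
    KeepsRelation : ∀ {n} → Pred (Relations L n) 0ℓ

open SubLanguage public

-- Subsets are turned into types by means of Refinement, whose membership proofs
-- are irrelevant, so that two elements are equal iff their values are.
language : ∀ {L} → SubLanguage L → Language
language {L} L₀ = record
  { Functions = λ n → Refinement (Functions L n) (KeepsFunction L₀)
  ; Relations = λ n → Refinement (Relations L n) (KeepsRelation L₀)
  }

infixl 6 _↾_

_↾_ : ∀ {L} → Structure L → (L₀ : SubLanguage L) → Structure (language L₀)
M ↾ L₀ = record
  { Carrier = Carrier M
  ; fun     = λ f → fun M (value f)
  ; rel     = λ R → rel M (value R)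
  }

record Isomorphism {L : Language} (M N : Structure L) : Set where
  field
    bijection : Carrier M ↔ Carrier N

  open Inverse bijection public using (to; from)

  field
    preserves-fun : ∀ {n} (f : Functions L n) (xs : Vec (Carrier M) n) →
                    to (fun M f xs) ≡ fun N f (map to xs)
    preserves-rel : ∀ {n} (R : Relations L n) (xs : Vec (Carrier M) n) →
                    rel M R xs ⇔ rel N R (map to xs)

open Isomorphism public using (to)

Automorphism : ∀ {L} → Structure L → Set
Automorphism M = Isomorphism M M

record Substructure {L : Language} (M : Structure L) : Set₁ where
  field
    Universe : Pred (Carrier M) 0ℓ
    closed   : ∀ {n} (f : Functions L n) {xs : Vec (Carrier M) n} →
               All Universe xs → Universe (fun M f xs)

open Substructure public

all-values : ∀ {A : Set} {P : Pred A 0ℓ} {n} (xs : Vec (Refinement A P) n) →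
             Irrelevant (All P (map value xs))
all-values []             = [ [] ]
all-values ((x , p) ∷ xs) = Irrelevant.zipWith _∷_ p (all-values xs)

structure : ∀ {L} {M : Structure L} → Substructure M → Structure L
structure {M = M} N = record
  { Carrier = Refinement (Carrier M) (Universe N)
  ; fun     = λ f xs → fun M f (map value xs)
                     , Irrelevant.map (closed N f) (all-values xs)
  ; rel     = λ R xs → rel M R (map value xs)
  }

SymmetricallyEmbedded : ∀ {L} {M : Structure L} → Substructure M → Set
SymmetricallyEmbedded {M = M} N =
  (σ : Automorphism (structure N)) →
  Σ[ τ ∈ Automorphism M ]
    (∀ (x : Carrier (structure N)) → to τ (value x) ≡ value (to σ x))

Monochromatic : ∀ {L} {M : Structure L} → (Carrier M → Bool) → Substructure M → Set
Monochromatic c N = ∃[ k ] (∀ x → Universe N x → c x ≡ k)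

SymmetricallyIndivisible : ∀ {L} → Structure L → Set₁
SymmetricallyIndivisible M =
  (c : Carrier M → Bool) →
  Σ[ N ∈ Substructure M ]
    Monochromatic c N × Isomorphism (structure N) M × SymmetricallyEmbedded N

{-# OPTIONS --safe #-}
-- The structure is ℕ × ℕ with two relations, one comparing the rows of two
-- points, the other comparing the columns of two points of the same row.  It is
-- rigid, so a monochromatic copy of it is automatically symmetrically embedded,
-- and a copy is found by choosing infinitely many rows in which one colour
-- occurs infinitely often.
--
-- Forgetting the order of the rows leaves a disjoint union of countably many
-- copies of ω, whose automorphisms permute the rows and preserve columns.  Colour
-- a point by whether it lies below the diagonal.  One colour has finitely many
-- points in each row.  A copy in the other colour meets infinitely many rows, and
-- its points in row r have columns ≥ r.  But an automorphism swapping two rows of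
-- the copy extends only if their first points have the same column.
module Submission where

open import Defs
open import Axiom.DoubleNegationElimination using (em⇒dne)
open import Axiom.ExcludedMiddle using (ExcludedMiddle)
open import Data.Bool.Base using (Bool; true; false; T)
open import Data.Bool.Properties using (¬-not) renaming (_≟_ to _≟ᵇ_)
open import Data.Empty using (⊥; ⊥-elim)
open import Data.Fin.Base using (fromℕ<)
open import Data.Fin.Properties using (fromℕ<-injective; ℕ→Fin-notInjective)
open import Data.Irrelevant using ([_])
open import Data.Nat.Base using (ℕ; zero; suc; _≤_; _<_; _<ᵇ_; _⊔_; z≤n; s≤s; z<s)
open import Data.Nat.Properties
  using (_≟_; ≤-antisym; ≤-trans; ≤-<-trans; <-trans; <-irrefl; <-asym; <⇒≱; ≮⇒≥; n<1+n;
         m≤n⇒m<n∨m≡n; m≤m⊔n; m≤n⊔m; <ᵇ⇒<; <⇒<ᵇ)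
open import Data.Product.Base using (Σ-syntax; ∃-syntax; _×_; _,_; proj₁; proj₂; map₁; map₂)
open import Data.Refinement.Base using (value; _,_)
open import Data.Refinement.Properties using (value-injective)
open import Data.Sum.Base using (_⊎_; inj₁; inj₂)
open import Data.Unit.Base using (⊤; tt)
open import Data.Vec.Base using (Vec; []; _∷_; map)
open import Data.Vec.Properties using (map-∘; map-cong; map-id)
open import Function.Base using (_∘_)
open import Function.Bundles using (_⇔_; mk⇔; mk↔ₛ′; module Inverse; module Equivalence)
open import Function.Construct.Composition using (_⇔-∘_)
open import Function.Construct.Identity using (⇔-id; ↔-id)
open import Function.Construct.Symmetry using (⇔-sym; ↔-sym)
open import Function.Definitions using (Injective; StrictlyInverseˡ)
open import Function.Properties.Inverse using (↔-trans)
open import Level using (0ℓ)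
open import Relation.Binary.Definitions using (Monotonic₁)
open import Relation.Binary.PropositionalEquality
  using (_≡_; refl; sym; trans; cong; cong₂; subst; subst₂; module ≡-Reasoning)
open import Relation.Nullary.Decidable.Core using (yes; no; recompute)
open import Relation.Nullary.Negation.Core using (¬_; contradiction)
open import Relation.Unary using (Pred; ∁)

-- Isomorphisms, rigid structures and images of self-embeddings.

module _ {L : Language} where

  iso-refl : {M : Structure L} → Isomorphism M M
  iso-refl {M} = record
    { bijection     = ↔-id (Carrier M)
    ; preserves-fun = λ f xs → cong (fun M f) (sym (map-id xs))
    ; preserves-rel = λ R xs → subst (λ ys → rel M R xs ⇔ rel M R ys) (sym (map-id xs)) (⇔-id _)
    }

  iso-sym : {M N : Structure L} → Isomorphism M N → Isomorphism N M
  iso-sym {M} {N} φ = record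
    { bijection     = ↔-sym bijection
    ; preserves-fun = λ f ys → begin
        from (fun N f ys)                       ≡⟨ cong (from ∘ fun N f) (to∘from ys) ⟨
        from (fun N f (map φ.to (map from ys))) ≡⟨ cong from (preserves-fun f (map from ys)) ⟨
        from (φ.to (fun M f (map from ys)))     ≡⟨ strictlyInverseʳ _ ⟩
        fun M f (map from ys)                   ∎
    ; preserves-rel = λ R ys →
        ⇔-sym (subst (λ zs → rel M R (map from ys) ⇔ rel N R zs)
                     (to∘from ys) (preserves-rel R (map from ys)))
    }
    where
    module φ = Isomorphism φ
    open φ using (bijection; preserves-fun; preserves-rel)
    open Inverse bijection using (from; strictlyInverseˡ; strictlyInverseʳ)
    open ≡-Reasoning
    to∘from : ∀ {n} (ys : Vec (Carrier N) n) → map φ.to (map from ys) ≡ ys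
    to∘from ys = trans (sym (map-∘ φ.to from ys))
                       (trans (map-cong strictlyInverseˡ ys) (map-id ys))

  iso-trans : {M N O : Structure L} → Isomorphism M N → Isomorphism N O → Isomorphism M O
  iso-trans {M} {N} {O} φ ψ = record
    { bijection     = ↔-trans φ.bijection ψ.bijection
    ; preserves-fun = λ f xs →
        trans (cong ψ.to (φ.preserves-fun f xs))
              (trans (ψ.preserves-fun f (map φ.to xs))
                     (cong (fun O f) (sym (map-∘ ψ.to φ.to xs))))
    ; preserves-rel = λ R xs →
        subst (λ ys → rel M R xs ⇔ rel O R ys) (sym (map-∘ ψ.to φ.to xs))
              (ψ.preserves-rel R (map φ.to xs) ⇔-∘ φ.preserves-rel R xs)
    }
    where
    module φ = Isomorphism φ
    module ψ = Isomorphism ψ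

  Rigid : Structure L → Set
  Rigid M = (σ : Automorphism M) → ∀ x → to σ x ≡ x

  -- Conjugating `σ` by `φ` gives an automorphism of `M`, which is trivial by rigidity. Hence `σ` is
  -- trivial too, and the identity of `M` extends it.
  rigid⇒symmetricallyEmbedded : {M : Structure L} → Rigid M → (N : Substructure M) →
                                Isomorphism (structure N) M → SymmetricallyEmbedded N
  rigid⇒symmetricallyEmbedded {M} rigid N φ σ = iso-refl , λ x → cong value (sym (σ-fixes x))
    where
    open Inverse (Isomorphism.bijection φ) using (from; strictlyInverseʳ)
    conjugate : Automorphism M
    conjugate = iso-trans (iso-sym φ) (iso-trans σ φ)
    σ-fixes : ∀ x → to σ x ≡ x
    σ-fixes x = begin
      to σ x                        ≡⟨ strictlyInverseʳ (to σ x) ⟨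
      from (to φ (to σ x))          ≡⟨ cong (from ∘ to φ ∘ to σ) (strictlyInverseʳ x) ⟨
      from (to conjugate (to φ x))  ≡⟨ cong from (rigid conjugate (to φ x)) ⟩
      from (to φ x)                 ≡⟨ strictlyInverseʳ x ⟩
      x                             ∎
      where open ≡-Reasoning

  module _ (em : ExcludedMiddle 0ℓ) (relational : ∀ {n} → ¬ Functions L n) {M : Structure L}
           (e : Carrier M → Carrier M) (e-injective : Injective _≡_ _≡_ e)
           (e-rel : ∀ {n} (R : Relations L n) xs → rel M R xs ⇔ rel M R (map e xs)) where

    image : Substructure M
    image = record
      { Universe = λ x → ∃[ y ] e y ≡ x
      ; closed   = λ f → ⊥-elim (relational f)
      }

    image-iso : Isomorphism M (structure image)
    image-iso = record
      { bijection     = mk↔ₛ′ into (proj₁ ∘ preimage)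
                              (λ x → value-injective (proj₂ (preimage x)))
                              (λ y → e-injective (proj₂ (preimage (into y))))
      ; preserves-fun = λ f → ⊥-elim (relational f)
      ; preserves-rel = λ R xs →
          subst (λ ys → rel M R xs ⇔ rel M R ys) (map-∘ value into xs) (e-rel R xs)
      }
      where
      into : Carrier M → Carrier (structure image)
      into y = e y , [ y , refl ]
      preimage : (x : Carrier (structure image)) → ∃[ y ] e y ≡ value x
      -- The membership proof `p` is irrelevant, so the preimage is recovered by deciding its
      -- existence with excluded middle.
      preimage (x , [ p ]) = recompute em p

-- Strictly increasing and bounded sequences of natural numbers.

StrictlyIncreasing : (ℕ → ℕ) → Set
StrictlyIncreasing = Monotonic₁ _<_ _<_

module _ {s : ℕ → ℕ} where

  step⇒strictlyIncreasing : (∀ n → s n < s (suc n)) → StrictlyIncreasing s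
  step⇒strictlyIncreasing step {m} {suc n} (s≤s m≤n) with m≤n⇒m<n∨m≡n m≤n
  ... | inj₁ m<n  = <-trans (step⇒strictlyIncreasing step m<n) (step n)
  ... | inj₂ refl = step n

  module _ (s-inc : StrictlyIncreasing s) where

    strictlyIncreasing⇒inflationary : ∀ n → n ≤ s n
    strictlyIncreasing⇒inflationary zero    = z≤n
    strictlyIncreasing⇒inflationary (suc n) =
      ≤-<-trans (strictlyIncreasing⇒inflationary n) (s-inc (n<1+n n))

    strictlyIncreasing⇒injective : Injective _≡_ _≡_ s
    strictlyIncreasing⇒injective eq =
      ≤-antisym (≮⇒≥ λ n<m → <-irrefl (sym eq) (s-inc n<m))
                (≮⇒≥ λ m<n → <-irrefl eq (s-inc m<n))

    strictlyIncreasing⇒reflects-< : ∀ {m n} → s m < s n → m < n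
    strictlyIncreasing⇒reflects-< {m} {n} sm<sn
      with m≤n⇒m<n∨m≡n {m} {n} (≮⇒≥ λ n<m → <-asym sm<sn (s-inc n<m))
    ... | inj₁ m<n  = m<n
    ... | inj₂ refl = contradiction sm<sn (<-irrefl refl)

bounded⇒¬injective : ∀ {r : ℕ → ℕ} {b} → (∀ n → r n < b) → ¬ Injective _≡_ _≡_ r
bounded⇒¬injective r<b r-inj =
  ℕ→Fin-notInjective (λ n → fromℕ< (r<b n))
    (λ {m} {n} eq → r-inj (fromℕ<-injective _ _ (r<b m) (r<b n) eq))

-- Infinite sets of natural numbers and their enumerations.

Unbounded : Pred (Pred ℕ 0ℓ) 0ℓ
Unbounded P = ∀ m → ∃[ n ] m ≤ n × P n

unbounded-mono : ∀ {P Q : Pred ℕ 0ℓ} → (∀ {n} → P n → Q n) → Unbounded P → Unbounded Q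
unbounded-mono P⊆Q P-unb m = map₂ (map₂ P⊆Q) (P-unb m)

unbounded-or-∁ : ExcludedMiddle 0ℓ → ∀ P → Unbounded P ⊎ Unbounded (∁ P)
unbounded-or-∁ em P with em {Unbounded (∁ P)}
... | yes ∁P-unb = inj₂ ∁P-unb
... | no ¬∁P-unb = inj₁ λ m → dne λ ¬∃P → ¬∁P-unb λ k →
  -- If `P` fails from `m` on, then beyond any `k` the point `m ⊔ k` lies in the complement.
  m ⊔ k , m≤n⊔m m k , λ p → ¬∃P (m ⊔ k , m≤m⊔n m k , p)
  where
  dne = em⇒dne em

module Enumeration {P : Pred ℕ 0ℓ} (P-unb : Unbounded P) where

  enum : ℕ → ℕ
  enum zero    = proj₁ (P-unb 0)
  enum (suc n) = proj₁ (P-unb (suc (enum n)))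

  enum-satisfies : ∀ n → P (enum n)
  enum-satisfies zero    = proj₂ (proj₂ (P-unb 0))
  enum-satisfies (suc n) = proj₂ (proj₂ (P-unb (suc (enum n))))

  enum-strictlyIncreasing : StrictlyIncreasing enum
  enum-strictlyIncreasing =
    step⇒strictlyIncreasing λ n → proj₁ (proj₂ (P-unb (suc (enum n))))

-- Either infinitely many rows contain `true` infinitely often, or infinitely many rows do not; each
-- row of the latter kind contains `false` infinitely often.
unbounded-colour : ExcludedMiddle 0ℓ → (c : ℕ → ℕ → Bool) →
                   ∃[ k ] Unbounded (λ i → Unbounded (λ j → c i j ≡ k))
unbounded-colour em c with unbounded-or-∁ em (λ i → Unbounded (λ j → c i j ≡ true))
... | inj₁ unb = true , unb
... | inj₂ unb = false , unbounded-mono row unb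
  where
  row : ∀ {i} → ¬ Unbounded (λ j → c i j ≡ true) → Unbounded (λ j → c i j ≡ false)
  row {i} ¬unb with unbounded-or-∁ em (λ j → c i j ≡ true)
  ... | inj₁ unb′ = contradiction unb′ ¬unb
  ... | inj₂ unb′ = unbounded-mono ¬-not unb′

-- The grid, its reduct and the symmetric indivisibility of the grid.

Point : Set
Point = ℕ × ℕ

row col : Point → ℕ
row = proj₁
col = proj₂

infix 4 _≺_ _⊏_

_≺_ : Point → Point → Set
x ≺ y = row x < row y

_⊏_ : Point → Point → Set
x ⊏ y = row x ≡ row y × col x < col y

-- Along a fixed column, the row coordinate of `g` is a strictly increasing sequence.
≺-mono⇒row-inflationary : ∀ g → Monotonic₁ _≺_ _≺_ g → ∀ x → row x ≤ row (g x)
≺-mono⇒row-inflationary g g-mono (i , j) = strictlyIncreasing⇒inflationary g-mono i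

⊏-mono⇒col-inflationary : ∀ g → Monotonic₁ _⊏_ _⊏_ g → ∀ x → col x ≤ col (g x)
⊏-mono⇒col-inflationary g g-mono (i , j) =
  strictlyIncreasing⇒inflationary (λ j<k → proj₂ (g-mono (refl , j<k))) j

⊏-mono⇒row-const : ∀ g → Monotonic₁ _⊏_ _⊏_ g → ∀ i j → row (g (i , j)) ≡ row (g (i , 0))
⊏-mono⇒row-const g g-mono i zero    = refl
⊏-mono⇒row-const g g-mono i (suc j) = sym (proj₁ (g-mono (refl , z<s)))

data Symbol : ℕ → Set where
  above left : Symbol 2

L : Language
L = record { Functions = λ _ → ⊥ ; Relations = Symbol }

Grid : Structure L
Grid = record
  { Carrier = Point
  ; fun     = λ ()
  ; rel     = λ { above (x ∷ y ∷ []) → x ≺ y ; left (x ∷ y ∷ []) → x ⊏ y }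
  }

L₀ : SubLanguage L
L₀ = record
  { KeepsFunction = λ _ → ⊤
  ; KeepsRelation = λ { above → ⊥ ; left → ⊤ }
  }

Rows : Structure (language L₀)
Rows = Grid ↾ L₀

-- Neither `σ` nor its inverse can decrease a row or a column, so `σ` preserves both coordinates.
Grid-rigid : Rigid Grid
Grid-rigid σ x = cong₂ _,_
  (fixes row (λ τ → ≺-mono⇒row-inflationary (to τ) (≺-mono τ)))
  (fixes col (λ τ → ⊏-mono⇒col-inflationary (to τ) (⊏-mono τ)))
  where
  ≺-mono : (τ : Automorphism Grid) → Monotonic₁ _≺_ _≺_ (to τ)
  ≺-mono τ {x} {y} = Equivalence.to (Isomorphism.preserves-rel τ above (x ∷ y ∷ []))
  ⊏-mono : (τ : Automorphism Grid) → Monotonic₁ _⊏_ _⊏_ (to τ)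
  ⊏-mono τ {x} {y} = Equivalence.to (Isomorphism.preserves-rel τ left (x ∷ y ∷ []))
  fixes : (f : Point → ℕ) → (∀ (τ : Automorphism Grid) y → f y ≤ f (to τ y)) → f (to σ x) ≡ f x
  fixes f inc = ≤-antisym
    (subst (λ y → f (to σ x) ≤ f y)
           (Inverse.strictlyInverseʳ (Isomorphism.bijection σ) x) (inc (iso-sym σ) (to σ x)))
    (inc σ x)

Grid-symmetricallyIndivisible : ExcludedMiddle 0ℓ → SymmetricallyIndivisible Grid
Grid-symmetricallyIndivisible em c with unbounded-colour em (λ i j → c (i , j))
... | k , unb = N , (k , λ { _ ((i , j) , refl) → T.enum-satisfies i j })
              , φ , rigid⇒symmetricallyEmbedded Grid-rigid N φ
  where
  module S = Enumeration unb
  module T i = Enumeration (S.enum-satisfies i)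
  s = S.enum
  t = T.enum
  s-inc = S.enum-strictlyIncreasing
  t-inc = T.enum-strictlyIncreasing
  s-injective : Injective _≡_ _≡_ s
  s-injective = strictlyIncreasing⇒injective s-inc
  e : Point → Point
  -- `s` lists the rows where colour `k` recurs forever, and `t i` lists the columns of that colour
  -- in row `s i`. The lists `t i` may differ between rows, since `left` compares columns only
  -- within a row.
  e (i , j) = s i , t i j
  e-injective : Injective _≡_ _≡_ e
  e-injective {i , j} {i′ , j′} eq with s-injective {i} {i′} (cong row eq)
  ... | refl = cong (i ,_) (strictlyIncreasing⇒injective (t-inc i) (cong col eq))
  ⊏-reflects : ∀ {x y} → e x ⊏ e y → x ⊏ y
  ⊏-reflects {i , j} {i′ , j′} (eq , lt) with s-injective {i} {i′} eq
  ... | refl = refl , strictlyIncreasing⇒reflects-< (t-inc i) lt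
  e-rel : ∀ {n} (R : Symbol n) xs → rel Grid R xs ⇔ rel Grid R (map e xs)
  e-rel above (x ∷ y ∷ []) = mk⇔ s-inc (strictlyIncreasing⇒reflects-< s-inc)
  e-rel left  (x ∷ y ∷ []) = mk⇔ (λ { (refl , lt) → refl , t-inc (row x) lt }) ⊏-reflects
  N : Substructure Grid
  N = image em (λ ()) e e-injective e-rel
  φ : Isomorphism (structure N) Grid
  φ = iso-sym (image-iso em (λ ()) e e-injective e-rel)

-- Automorphisms of the reduct that swap two rows.

transpose : ℕ → ℕ → ℕ → ℕ
transpose i j k with k ≟ i | k ≟ j
... | yes _ | _     = j
... | no _  | yes _ = i
... | no _  | no _  = k

transpose-left : ∀ i j → transpose i j i ≡ j
transpose-left i j with i ≟ i | i ≟ j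
... | yes _  | _ = refl
... | no i≢i | _ = contradiction refl i≢i

transpose-right : ∀ i j → transpose i j j ≡ i
transpose-right i j with j ≟ i | j ≟ j
... | yes j≡i | _      = j≡i
... | no _    | yes _  = refl
... | no _    | no j≢j = contradiction refl j≢j

transpose-involutive : ∀ i j → StrictlyInverseˡ _≡_ (transpose i j) (transpose i j)
transpose-involutive i j k with k ≟ i in eq | k ≟ j in eq′
... | yes refl | _        = transpose-right k j
... | no _     | yes refl = transpose-left i k
-- The outer `transpose` repeats both comparisons on the unchanged `k`, so their recorded outcomes
-- make it reduce.
... | no _     | no _ rewrite eq | eq′ = refl

swap-rows : ℕ → ℕ → Automorphism Rows
swap-rows i j = record
  { bijection     = mk↔ₛ′ π π π-involutive π-involutive
  ; preserves-fun = λ { (() , _) }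
  ; preserves-rel = λ { (above , [ () ])
                      ; (left , _) (x ∷ y ∷ []) → mk⇔ (π-mono {x} {y}) (π-reflects {x} {y}) }
  }
  where
  π : Point → Point
  π = map₁ (transpose i j)
  π-involutive : StrictlyInverseˡ _≡_ π π
  π-involutive (k , l) = cong (_, l) (transpose-involutive i j k)
  π-mono : Monotonic₁ _⊏_ _⊏_ π
  π-mono (eq , lt) = cong (transpose i j) eq , lt
  π-reflects : ∀ {x y} → π x ⊏ π y → x ⊏ y
  π-reflects {x} {y} p = subst₂ _⊏_ (π-involutive x) (π-involutive y) (π-mono {π x} {π y} p)

-- The diagonal colouring and the copies of the reduct.

belowDiagonal : Point → Bool
belowDiagonal (i , j) = j <ᵇ i

module _ (N : Substructure Rows) (φ : Isomorphism (structure N) Rows) where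

  private
    φ⁻¹ = iso-sym φ

  embed : Point → Point
  embed x = value (to φ⁻¹ x)

  embed-⊏ : ∀ x y → x ⊏ y ⇔ embed x ⊏ embed y
  embed-⊏ x y = Isomorphism.preserves-rel φ⁻¹ (left , [ tt ]) (x ∷ y ∷ [])

  embed-mono : Monotonic₁ _⊏_ _⊏_ embed
  embed-mono {x} {y} = Equivalence.to (embed-⊏ x y)

  embed-colour : ∀ (c : Point → Bool) {k} → (∀ x → Universe N x → c x ≡ k) → ∀ x → c (embed x) ≡ k
  embed-colour c {k} mono x with to φ⁻¹ x
  -- Equality of colours is decidable, so an irrelevant proof of membership suffices.
  ... | y , [ p ] = recompute (c y ≟ᵇ k) (mono y p)

  rowMap : ℕ → ℕ
  rowMap i = row (embed (i , 0))

  -- Far enough to the right, any row of the copy passes the first point of every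
  -- row of the copy that lies in the same row of the ambient structure.
  rowMap-injective : Injective _≡_ _≡_ rowMap
  rowMap-injective {i} {i′} eq = proj₁ (Equivalence.from (embed-⊏ x y)
    ( trans eq (sym (⊏-mono⇒row-const embed embed-mono i′ _))
    , ⊏-mono⇒col-inflationary embed embed-mono y ))
    where
    x y : Point
    x = i , 0
    y = i′ , suc (col (embed x))

  -- Swapping rows `i` and `0` of the copy extends to an automorphism `τ` of `Rows`. It carries the
  -- first point of one row to the first point of the other, and it cannot decrease columns.
  symmetricallyEmbedded⇒col≤ : SymmetricallyEmbedded N →
                               ∀ i → col (embed (i , 0)) ≤ col (embed (0 , 0))
  symmetricallyEmbedded⇒col≤ sym-emb i
    with sym-emb (iso-trans φ (iso-trans (swap-rows i 0) φ⁻¹))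
  ... | τ , extends =
    subst (λ y → col (embed x) ≤ col y) τx≡ (⊏-mono⇒col-inflationary (to τ) τ-mono (embed x))
    where
    x : Point
    x = i , 0
    τ-mono : Monotonic₁ _⊏_ _⊏_ (to τ)
    τ-mono {y} {z} = Equivalence.to (Isomorphism.preserves-rel τ (left , [ tt ]) (y ∷ z ∷ []))
    τx≡ : to τ (embed x) ≡ embed (0 , 0)
    τx≡ = begin
      to τ (embed x)                               ≡⟨ extends (to φ⁻¹ x) ⟩
      embed (to (swap-rows i 0) (to φ (to φ⁻¹ x))) ≡⟨ cong (embed ∘ to (swap-rows i 0)) (to∘from x) ⟩
      embed (transpose i 0 i , 0)                  ≡⟨ cong (λ k → embed (k , 0)) (transpose-left i 0) ⟩
      embed (0 , 0)                                ∎
      where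
      open ≡-Reasoning
      open Inverse (Isomorphism.bijection φ) using () renaming (strictlyInverseˡ to to∘from)

Rows-¬symmetricallyIndivisible : ¬ SymmetricallyIndivisible Rows
Rows-¬symmetricallyIndivisible indiv with indiv belowDiagonal
... | N , (true , mono) , φ , _ = <⇒≱ col<row row≤col
  where
  r = rowMap N φ 0
  -- Row `0` of the copy lies in the ambient row `r`, where only `r` points are below the diagonal.
  -- Its point of index `r` therefore already has column at least `r`.
  x = 0 , r
  col<row : col (embed N φ x) < r
  col<row = subst (col (embed N φ x) <_) (⊏-mono⇒row-const (embed N φ) (embed-mono N φ) 0 r)
    (<ᵇ⇒< _ _ (subst T (sym (embed-colour N φ belowDiagonal mono x)) tt))
  row≤col : r ≤ col (embed N φ x)
  row≤col = ⊏-mono⇒col-inflationary (embed N φ) (embed-mono N φ) x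
... | N , (false , mono) , φ , sym-emb = bounded⇒¬injective rowMap< (rowMap-injective N φ)
  where
  row≤col : ∀ x → row (embed N φ x) ≤ col (embed N φ x)
  row≤col x = ≮⇒≥ λ lt → subst T (embed-colour N φ belowDiagonal mono x) (<⇒<ᵇ lt)
  -- On or above the diagonal, the row of a first point is at most its column, which the row swaps
  -- bound uniformly. So the copy would meet only finitely many rows.
  rowMap< : ∀ i → rowMap N φ i < suc (col (embed N φ (0 , 0)))
  rowMap< i = s≤s (≤-trans (row≤col (i , 0)) (symmetricallyEmbedded⇒col≤ N φ sym-emb i))

theorem3p11 : ExcludedMiddle 0ℓ →
    Σ[ L ∈ Language ] Σ[ L₀ ∈ SubLanguage L ] Σ[ M ∈ Structure L ]
    SymmetricallyIndivisible M × ¬ SymmetricallyIndivisible (M ↾ L₀)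
theorem3p11 em =
  L , L₀ , Grid , Grid-symmetricallyIndivisible em , Rows-¬symmetricallyIndivisible
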